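{- Let $U$ be an $(r-1,k)_q$-evasive subspace of $V=V(r,q^n)$. (1) If $k<(r-1)n$, then $\dim_q U\le n+k-1$. (2) If $k<r-2+\frac{n}{r-1}$, then $\dim_q U\le n+k-r+1$.
   Context: $V(r,q^n)$ denotes an $r$-dimensional vector space over $\mathbb{F}_{q^n}$, viewed also as an $rn$-dimensional vector space over $\mathbb{F}_q$. For positive integers $h,k$, an $\mathbb{F}_q$-subspace $U$ of $V$ is $(h,k)_q$-evasive if $\langle U\rangle_{\mathbb{F}_{q^n}}$ has $\mathbb{F}_{q^n}$-dimension at least $h$ and every $h$-dimensional $\mathbb{F}_{q^n}$-subspace of $V$ meets $U$ in an $\mathbb{F}_q$-subspace of $\mathbb{F}_q$-dimension at most $k$. -}

module Defs where

open import Data.Nat using (ℕ; zero; suc; _≤_)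
open import Data.Fin using (Fin)
open import Data.Product using (Σ; ∃; _×_)
open import Relation.Nullary using (¬_)
open import Relation.Binary.PropositionalEquality using (_≡_)
open import Algebra.Structures using (IsCommutativeRing)

record Field : Set₁ where
  infixl 6 _+_
  infixl 7 _*_
  field
    Carrier : Set
    _+_ _*_ : Carrier → Carrier → Carrier
    -_      : Carrier → Carrier
    0# 1#   : Carrier
    isCommutativeRing : IsCommutativeRing _≡_ _+_ _*_ -_ 0# 1#
    0≢1     : ¬ (0# ≡ 1#)
    inverse : ∀ x → ¬ (x ≡ 0#) → Σ Carrier (λ y → x * y ≡ 1#)

-- An embedding of fields F ↪ L (injective unital ring homomorphism);
-- its image is the subfield of L over which L is viewed as a vector space.
record FieldEmbedding (F L : Field) : Set where
  private
    module F = Field F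
    module L = Field L
  field
    map     : F.Carrier → L.Carrier
    map-+   : ∀ x y → map (x F.+ y) ≡ map x L.+ map y
    map-*   : ∀ x y → map (x F.* y) ≡ map x L.* map y
    map-1   : map F.1# ≡ L.1#
    map-inj : ∀ x y → map x ≡ map y → x ≡ y

module Over (F L : Field) (ι : FieldEmbedding F L) (r : ℕ) where
  private
    module F = Field F
    module L = Field L
    module ι = FieldEmbedding ι

  V : Set
  V = Fin r → L.Carrier

  _≈_ : V → V → Set
  u ≈ v = ∀ i → u i ≡ v i

  0V : V
  0V _ = L.0#

  _+V_ : V → V → V
  (u +V v) i = u i L.+ v i

  _·_ : L.Carrier → V → V
  (a · v) i = a L.* v i

  lincomb : ∀ {d} → (Fin d → L.Carrier) → (Fin d → V) → V
  lincomb {zero}  a v = 0V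
  lincomb {suc d} a v = (a Fin.zero · v Fin.zero) +V lincomb (λ i → a (Fin.suc i)) (λ i → v (Fin.suc i))
    where import Data.Fin as Fin

  lincombF : ∀ {d} → (Fin d → F.Carrier) → (Fin d → V) → V
  lincombF c v = lincomb (λ i → ι.map (c i)) v

  Pred : Set₁
  Pred = V → Set

  record IsSubspaceF (U : Pred) : Set where
    field
      resp  : ∀ {u v} → u ≈ v → U u → U v
      zero∈ : U 0V
      +∈    : ∀ {u v} → U u → U v → U (u +V v)
      ·∈    : ∀ c {u} → U u → U (ι.map c · u)

  record IsSubspaceL (W : Pred) : Set where
    field
      resp  : ∀ {u v} → u ≈ v → W u → W v
      zero∈ : W 0V
      +∈    : ∀ {u v} → W u → W v → W (u +V v)
      ·∈    : ∀ a {u} → W u → W (a · u)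

  IsBasisF : (X : Pred) (d : ℕ) → (Fin d → V) → Set
  IsBasisF X d b =
    (∀ i → X (b i))
    × (∀ c → lincombF c b ≈ 0V → ∀ i → c i ≡ F.0#)
    × (∀ u → X u → Σ (Fin d → F.Carrier) (λ c → u ≈ lincombF c b))

  IsBasisL : (X : Pred) (d : ℕ) → (Fin d → V) → Set
  IsBasisL X d b =
    (∀ i → X (b i))
    × (∀ a → lincomb a b ≈ 0V → ∀ i → a i ≡ L.0#)
    × (∀ u → X u → Σ (Fin d → L.Carrier) (λ a → u ≈ lincomb a b))

  DimF≤ : Pred → ℕ → Set
  DimF≤ X m = ∀ d (b : Fin d → V) → IsBasisF X d b → d ≤ m

  SpanL : Pred → Pred
  SpanL U v = Σ ℕ (λ m → Σ (Fin m → V) (λ u → (∀ i → U (u i))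
                × Σ (Fin m → L.Carrier) (λ a → v ≈ lincomb a u)))

  DimL≥ : Pred → ℕ → Set
  DimL≥ X h = Σ ℕ (λ d → Σ (Fin d → V) (λ b → IsBasisL X d b × h ≤ d))

  IsSubspaceLOfDim : Pred → ℕ → Set
  IsSubspaceLOfDim W h = IsSubspaceL W × Σ (Fin h → V) (IsBasisL W h)

  _∩_ : Pred → Pred → Pred
  (U ∩ W) v = U v × W v

  IsEvasive : ℕ → ℕ → Pred → Set₁
  IsEvasive h k U =
    DimL≥ (SpanL U) h
    × (∀ (W : Pred) → IsSubspaceLOfDim W h → DimF≤ (U ∩ W) k)

-- For a basis b₁, …, b_d of U the vectors (a·b₁, …, a·b_d) with a ∈ L^r form a
-- rank-metric code over F with n × d matrices, in which the codeword of a ≠ 0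
-- has rank d - dim_F (U ∩ a^⊥) ≥ d - k.  The theorem follows from the Singleton
-- bound rn ≤ t (n - (t - k - 1)) applied to t = n + k members of b in case (1),
-- and to t = n + k - r + 2 members in case (2).

module Submission where

open import Defs
open import Algebra.Bundles using (CommutativeRing)
open import Data.Nat using (ℕ; zero; suc; _+_; _*_; _∸_; _^_; _≤_; _<_; z≤n; s≤s; s≤s⁻¹)
import Data.Nat.Properties as ℕ
open import Data.Nat.Solver using (module +-*-Solver)
open import Data.Fin using (Fin; zero; suc; punchIn; splitAt; remQuot; combine; finToFun; funToFin; _↑ˡ_; _↑ʳ_)
open import Data.Fin.Properties as Fin using (any?; all?; ¬∀⟶∃¬; pigeonhole)
open import Data.Sum using (inj₁; inj₂)
open import Data.Unit using (⊤; tt)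
open import Data.Product using (Σ; ∃; ∃₂; _×_; _,_; proj₁; proj₂)
open import Data.Vec.Functional using (_∷_; insertAt; removeAt)
open import Data.Vec.Functional.Properties using (insertAt-lookup; insertAt-punchIn)
open import Function using (_∘_; id)
open import Function.Bundles using (_↔_; Inverse; Injection)
open import Function.Properties.Inverse using (↔⇒↣; ↔-sym)
open import Level using (0ℓ)
open import Relation.Binary.Definitions using (DecidableEquality)
open import Relation.Binary.PropositionalEquality hiding (resp)
open import Relation.Nullary using (¬_; Dec; yes; no; contradiction)
open import Relation.Nullary.Decidable using (via-injection)

-- Evasiveness only bounds the lengths of bases, and `U` is an arbitrary predicate, so it can be
-- used only by exhibiting a basis of U ∩ a^⊥. Such a basis is cut out of `b` by F-linear
-- functionals, each of which costs at most one vector. Comparisons of lengths rest on counting: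
-- both fields are finite, so the pigeonhole principle on coefficient vectors replaces a theory of
-- dimension. The Singleton bound is used as rn ≤ (k + 1 + s)m with s + m = n, where m is the number
-- of coordinates kept in each entry. For m = 1 it reads (r - 1)n ≤ k, and for m = r - 1 it reads n
-- ≤ (r - 1)(k - r + 2); these are the negations of the two hypotheses. The second choice requires r
-- - 1 ≤ n. This follows from the hypothesis of (2) once k ≥ r - 1 is known, and that is where the
-- condition on the L-span of `U` enters.

↑-elim : ∀ s {m} (P : Fin (s + m) → Set) → (∀ i → P (i ↑ˡ m)) → (∀ i → P (s ↑ʳ i)) → ∀ i → P i
↑-elim s P left right i with splitAt s i in eq
... | inj₁ j = subst P (Fin.splitAt⁻¹-↑ˡ eq) (left j)
... | inj₂ j = subst P (Fin.splitAt⁻¹-↑ʳ eq) (right j)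

-- Finite types and the pigeonhole principle

to-injective : ∀ {A B : Set} (e : A ↔ B) {x y} → Inverse.to e x ≡ Inverse.to e y → x ≡ y
to-injective e = Injection.injective (↔⇒↣ e)

↔Fin⇒≟ : ∀ {A : Set} {p} → A ↔ Fin p → DecidableEquality A
↔Fin⇒≟ e = via-injection (↔⇒↣ e) Fin._≟_

module _ {A B : Set} {p p′} (A↔ : A ↔ Fin p) (B↔ : B ↔ Fin p′) where
  private
    module A = Inverse A↔
    module B = Inverse B↔

  -- Functions are coded by numbers, which determine them only pointwise. Distinct codes therefore
  -- give functions that are not pointwise equal, and decidable equality on `A` turns this into an
  -- index where they differ.
  collision : ∀ {s t} → p′ ^ t < p ^ s → (g : (Fin s → A) → (Fin t → B)) →
              ∃₂ λ x y → (∃ λ i → ¬ x i ≡ y i) × (∀ j → g x j ≡ g y j)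
  collision {s} {t} lt g with pigeonhole lt (λ k → funToFin (B.to ∘ g (A.from ∘ finToFun k)))
  ... | i , j , i<j , eq = A.from ∘ finToFun i , A.from ∘ finToFun j , differ , agree
    where
    differ : ∃ λ l → ¬ A.from (finToFun i l) ≡ A.from (finToFun j l)
    differ = ¬∀⟶∃¬ s _ (λ l → ↔Fin⇒≟ A↔ _ _) λ same →
      Fin.<⇒≢ i<j (trans (sym (Fin.funToFin-finToFin {s} {p} i))
        (trans (funToFin-cong λ l → to-injective (↔-sym A↔) (same l))
               (Fin.funToFin-finToFin {s} {p} j)))
      where
      funToFin-cong : ∀ {m n} {f g : Fin m → Fin n} → (∀ l → f l ≡ g l) → funToFin f ≡ funToFin g
      funToFin-cong {zero} _ = refl
      funToFin-cong {suc m} f≗g = cong₂ combine (f≗g zero) (funToFin-cong (f≗g ∘ suc))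

    agree : ∀ l → g (A.from ∘ finToFun i) l ≡ g (A.from ∘ finToFun j) l
    agree l = to-injective B↔ (begin
      B.to (g (A.from ∘ finToFun i) l)                              ≡⟨ Fin.finToFun-funToFin (B.to ∘ g (A.from ∘ finToFun i)) l ⟨
      finToFun {p′} {t} (funToFin (B.to ∘ g (A.from ∘ finToFun i))) l ≡⟨ cong (λ k → finToFun {p′} {t} k l) eq ⟩
      finToFun {p′} {t} (funToFin (B.to ∘ g (A.from ∘ finToFun j))) l ≡⟨ Fin.finToFun-funToFin (B.to ∘ g (A.from ∘ finToFun j)) l ⟩
      B.to (g (A.from ∘ finToFun j) l)                              ∎)
      where open ≡-Reasoning

-- Arithmetic in a field

module FieldProperties (K : Field) where
  private module K = Field K
  open Field K public

  commutativeRing : CommutativeRing 0ℓ 0ℓ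
  commutativeRing = record { isCommutativeRing = isCommutativeRing }

  open CommutativeRing commutativeRing public
    using (+-assoc; +-comm; +-congˡ; +-congʳ; *-congˡ; *-congʳ; +-identityˡ; +-identityʳ; -‿inverseˡ; -‿inverseʳ;
           *-assoc; *-comm; *-identityˡ; *-identityʳ; zeroˡ; zeroʳ; distribˡ; distribʳ;
           semiring; ring; commutativeSemiring)
  open import Algebra.Properties.Ring ring public
    using (-‿distribˡ-*; +-cancelʳ)
  open import Algebra.Properties.Semiring.Sum semiring public
    using (sum; sum-cong-≗; sum-remove; ∑-distrib-+; *-distribˡ-sum; sum-replicate-zero)
  open import Algebra.Solver.Ring.NaturalCoefficients.Default commutativeSemiring public
    using (solve; _:=_; _:+_; _:*_)

  x-y+y≡x : ∀ x y → (x K.+ (- y)) K.+ y ≡ x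
  x-y+y≡x x y = trans (+-assoc x (- y) y) (trans (cong (x K.+_) (-‿inverseˡ y)) (+-identityʳ x))

  x-y≡0⇒x≡y : ∀ {x y} → x K.+ (- y) ≡ 0# → x ≡ y
  x-y≡0⇒x≡y {x} {y} eq = trans (sym (x-y+y≡x x y)) (trans (cong (K._+ y) eq) (+-identityˡ y))

  x+x≡x⇒x≡0 : ∀ {x} → x K.+ x ≡ x → x ≡ 0#
  x+x≡x⇒x≡0 {x} eq = +-cancelʳ x x 0# (trans eq (sym (+-identityˡ x)))

  sum-single : ∀ {d} (f : Fin d → Carrier) p → (∀ j → ¬ j ≡ p → f j ≡ 0#) → sum f ≡ f p
  sum-single {suc d} f p f≡0 = trans (sum-remove {i = p} f)
    (trans (+-congˡ (trans (sum-cong-≗ (λ j → f≡0 (punchIn p j) (Fin.punchInᵢ≢i p j))) (sum-replicate-zero d)))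
           (+-identityʳ _))

  1<card : ∀ {p} → Carrier ↔ Fin p → 1 < p
  1<card {zero} e with Inverse.to e 0#
  ... | ()
  1<card {suc zero} e = contradiction (to-injective e (Fin1 _ _)) 0≢1
    where
    Fin1 : (i j : Fin 1) → i ≡ j
    Fin1 zero zero = refl
  1<card {suc (suc p)} e = s≤s (s≤s z≤n)

-- With this embedding every statement about F-linear algebra specialises to L-linear algebra, so
-- one development serves both base fields.
idEmbedding : (K : Field) → FieldEmbedding K K
idEmbedding K = record
  { map = id ; map-+ = λ _ _ → refl ; map-* = λ _ _ → refl ; map-1 = refl ; map-inj = λ _ _ → id }

-- Linear combinations, spans and independence

module LinearAlgebra (F L : Field) (ι : FieldEmbedding F L) (r : ℕ) where
  private
    module F = FieldProperties F
    module L = FieldProperties L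
    module ι = FieldEmbedding ι
  open Over F L ι r
  open ≡-Reasoning

  ι-0 : ι.map F.0# ≡ L.0#
  ι-0 = L.x+x≡x⇒x≡0 (trans (sym (ι.map-+ _ _)) (cong ι.map (F.+-identityˡ _)))

  lincomb≡sum : ∀ {d} (a : Fin d → L.Carrier) (v : Fin d → V) i →
                lincomb a v i ≡ L.sum (λ j → a j L.* v j i)
  lincomb≡sum {zero} a v i = refl
  lincomb≡sum {suc d} a v i = L.+-congˡ (lincomb≡sum (a ∘ suc) (v ∘ suc) i)

  lincomb-remove : ∀ {d} (a : Fin (suc d) → L.Carrier) (v : Fin (suc d) → V) p i →
                   lincomb a v i ≡ a p L.* v p i L.+ lincomb (removeAt a p) (removeAt v p) i
  lincomb-remove a v p i = begin
    lincomb a v i                            ≡⟨ lincomb≡sum a v i ⟩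
    L.sum (λ j → a j L.* v j i)              ≡⟨ L.sum-remove {i = p} (λ j → a j L.* v j i) ⟩
    a p L.* v p i L.+ L.sum (λ j → removeAt a p j L.* removeAt v p j i)
      ≡⟨ L.+-congˡ (lincomb≡sum (removeAt a p) (removeAt v p) i) ⟨
    _ ∎

  lincombF-cong : ∀ {d} {c c′ : Fin d → F.Carrier} {v v′ : Fin d → V} →
                  (∀ j → c j ≡ c′ j) → (∀ j → v j ≈ v′ j) → lincombF c v ≈ lincombF c′ v′
  lincombF-cong {zero} c≗ v≈ i = refl
  lincombF-cong {suc d} c≗ v≈ i =
    cong₂ L._+_ (cong₂ L._*_ (cong ι.map (c≗ zero)) (v≈ zero i)) (lincombF-cong (c≗ ∘ suc) (v≈ ∘ suc) i)

  lincombF-+ : ∀ {d} (c c′ : Fin d → F.Carrier) v →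
               lincombF (λ j → c j F.+ c′ j) v ≈ (lincombF c v +V lincombF c′ v)
  lincombF-+ c c′ v i = begin
    lincombF (λ j → c j F.+ c′ j) v i                     ≡⟨ lincomb≡sum _ v i ⟩
    L.sum (λ j → ι.map (c j F.+ c′ j) L.* v j i)
      ≡⟨ L.sum-cong-≗ (λ j → trans (cong (L._* v j i) (ι.map-+ _ _)) (L.distribʳ _ _ _)) ⟩
    L.sum (λ j → ι.map (c j) L.* v j i L.+ ι.map (c′ j) L.* v j i)
      ≡⟨ L.∑-distrib-+ (λ j → ι.map (c j) L.* v j i) _ ⟩
    L.sum (λ j → ι.map (c j) L.* v j i) L.+ L.sum (λ j → ι.map (c′ j) L.* v j i)
      ≡⟨ cong₂ L._+_ (lincomb≡sum _ v i) (lincomb≡sum _ v i) ⟨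
    (lincombF c v +V lincombF c′ v) i                     ∎

  lincombF-· : ∀ {d} x (c : Fin d → F.Carrier) v →
               lincombF (λ j → x F.* c j) v ≈ (ι.map x · lincombF c v)
  lincombF-· x c v i = begin
    lincombF (λ j → x F.* c j) v i                        ≡⟨ lincomb≡sum _ v i ⟩
    L.sum (λ j → ι.map (x F.* c j) L.* v j i)
      ≡⟨ L.sum-cong-≗ (λ j → trans (cong (L._* v j i) (ι.map-* _ _)) (L.*-assoc _ _ _)) ⟩
    L.sum (λ j → ι.map x L.* (ι.map (c j) L.* v j i))     ≡⟨ L.*-distribˡ-sum (ι.map x) (λ j → ι.map (c j) L.* v j i) ⟨
    ι.map x L.* L.sum (λ j → ι.map (c j) L.* v j i)       ≡⟨ L.*-congˡ (lincomb≡sum _ v i) ⟨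
    (ι.map x · lincombF c v) i                            ∎

  lincombF-0 : ∀ {d} (v : Fin d → V) → lincombF (λ _ → F.0#) v ≈ 0V
  lincombF-0 {zero} v i = refl
  lincombF-0 {suc d} v i =
    trans (cong₂ L._+_ (trans (cong (L._* v zero i) ι-0) (L.zeroˡ _)) (lincombF-0 (v ∘ suc) i)) (L.+-identityʳ _)

  Independent : ∀ {d} → (Fin d → V) → Set
  Independent b = ∀ c → lincombF c b ≈ 0V → ∀ i → c i ≡ F.0#

  InSpan : ∀ {d} → (Fin d → V) → Pred
  InSpan {d} b u = Σ (Fin d → F.Carrier) λ c → u ≈ lincombF c b

  inSpan-0 : ∀ {d} {b : Fin d → V} → InSpan b 0V
  inSpan-0 {b = b} = (λ _ → F.0#) , λ i → sym (lincombF-0 b i)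

  inSpan-+ : ∀ {d} {b : Fin d → V} {u v} → InSpan b u → InSpan b v → InSpan b (u +V v)
  inSpan-+ {b = b} (c , p) (c′ , p′) =
    (λ j → c j F.+ c′ j) , λ i → trans (cong₂ L._+_ (p i) (p′ i)) (sym (lincombF-+ c c′ b i))

  inSpan-· : ∀ {d} {b : Fin d → V} x {u} → InSpan b u → InSpan b (ι.map x · u)
  inSpan-· {b = b} x (c , p) =
    (λ j → x F.* c j) , λ i → trans (L.*-congˡ (p i)) (sym (lincombF-· x c b i))

  inSpan-lincombF : ∀ {d t} {b : Fin d → V} (x : Fin t → F.Carrier) (c : Fin t → V) →
                    (∀ j → InSpan b (c j)) → InSpan b (lincombF x c)
  inSpan-lincombF {t = zero} x c _ = inSpan-0
  inSpan-lincombF {t = suc t} x c c∈ =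
    inSpan-+ (inSpan-· (x zero) (c∈ zero)) (inSpan-lincombF (x ∘ suc) (c ∘ suc) (c∈ ∘ suc))

  coefficients-unique : ∀ {d} {b : Fin d → V} → Independent b → ∀ c c′ →
                        lincombF c b ≈ lincombF c′ b → ∀ i → c i ≡ c′ i
  coefficients-unique {b = b} ind c c′ eq i = F.x-y≡0⇒x≡y (ind (λ j → c j F.+ (F.- c′ j)) diff i)
    where
    diff : lincombF (λ j → c j F.+ (F.- c′ j)) b ≈ 0V
    diff l = L.+-cancelʳ (lincombF c′ b l) _ _ (begin
      lincombF (λ j → c j F.+ (F.- c′ j)) b l L.+ lincombF c′ b l ≡⟨ lincombF-+ _ c′ b l ⟨
      lincombF (λ j → (c j F.+ (F.- c′ j)) F.+ c′ j) b l
        ≡⟨ lincombF-cong {v = b} (λ j → F.x-y+y≡x (c j) (c′ j)) (λ _ _ → refl) l ⟩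
      lincombF c b l                                              ≡⟨ eq l ⟩
      lincombF c′ b l                                             ≡⟨ L.+-identityˡ _ ⟨
      L.0# L.+ lincombF c′ b l                                    ∎)

  -- If d < t, two of the q^t combinations of `c` have the same coefficient vector over `b`, since
  -- there are only q^d of those. They are then equal, against independence.
  independent⇒≤span : ∀ {q t d} → F.Carrier ↔ Fin q → {c : Fin t → V} {b : Fin d → V} →
                      Independent c → (∀ j → InSpan b (c j)) → t ≤ d
  independent⇒≤span {q} {t} {d} F↔ {c} {b} ind c∈ = ℕ.≮⇒≥ λ d<t →
    let coeff : (x : Fin t → F.Carrier) → InSpan b (lincombF x c)
        coeff x = inSpan-lincombF x c c∈
        x , y , (i , x≢y) , eq = collision F↔ F↔ (ℕ.^-monoʳ-< q (F.1<card F↔) d<t) (proj₁ ∘ coeff)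
    in x≢y (coefficients-unique ind x y
         (λ l → trans (proj₂ (coeff x) l)
                  (trans (lincombF-cong {v = b} eq (λ _ _ → refl) l) (sym (proj₂ (coeff y) l)))) i)

  independent-tail : ∀ {d} {b : Fin (suc d) → V} → Independent b → Independent (b ∘ suc)
  independent-tail {b = b} ind c eq i = ind (F.0# ∷ c)
    (λ l → trans (L.+-congʳ (trans (cong (L._* b zero l) ι-0) (L.zeroˡ _)))
             (trans (L.+-identityˡ _) (eq l))) (suc i)

  independent-drop : ∀ x {d} {b : Fin (x + d) → V} → Independent b → Independent (b ∘ (x ↑ʳ_))
  independent-drop zero ind = ind
  independent-drop (suc x) {b = b} ind = independent-drop x {b = b ∘ suc} (independent-tail {b = b} ind)

  independent-subfamily : ∀ {d e} {b : Fin d → V} → e ≤ d → Independent b →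
                          Σ (Fin e → Fin d) λ f → Independent (b ∘ f)
  independent-subfamily {e = e} {b} e≤d ind
    with o , e+o≡d ← ℕ.m≤n⇒∃[o]m+o≡n e≤d
    with refl ← trans (ℕ.+-comm o e) e+o≡d =
    (o ↑ʳ_) , independent-drop o {b = b} ind

  -- Functionals and families in their kernels

  record Functional : Set where
    field
      ⟨_⟩    : V → F.Carrier
      ⟨⟩-cong : ∀ {u v} → u ≈ v → ⟨ u ⟩ ≡ ⟨ v ⟩
      ⟨⟩-+    : ∀ u v → ⟨ u +V v ⟩ ≡ ⟨ u ⟩ F.+ ⟨ v ⟩
      ⟨⟩-·    : ∀ x u → ⟨ ι.map x · u ⟩ ≡ x F.* ⟨ u ⟩

    ⟨⟩-0 : ⟨ 0V ⟩ ≡ F.0#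
    ⟨⟩-0 = F.x+x≡x⇒x≡0 (trans (sym (⟨⟩-+ 0V 0V)) (⟨⟩-cong λ _ → L.+-identityʳ _))

  open Functional

  scale : F.Carrier → Functional → Functional
  scale z φ = record
    { ⟨_⟩ = λ u → z F.* ⟨ φ ⟩ u
    ; ⟨⟩-cong = λ eq → cong (z F.*_) (⟨⟩-cong φ eq)
    ; ⟨⟩-+ = λ u v → trans (cong (z F.*_) (⟨⟩-+ φ u v)) (F.distribˡ z _ _)
    ; ⟨⟩-· = λ x u → trans (cong (z F.*_) (⟨⟩-· φ x u))
        (F.solve 3 (λ z x y → z F.:* (x F.:* y) F.:= x F.:* (z F.:* y)) refl z x (⟨ φ ⟩ u))
    }

  -- A rank-one change of the identity. When the functional takes the value -1 at `w`, it is the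
  -- projection onto the kernel along `w`.
  shear : Functional → V → V → V
  shear φ w v = v +V (ι.map (⟨ φ ⟩ v) · w)

  lincombF-shear : ∀ φ w {d} (c : Fin d → F.Carrier) v →
                   lincombF c (shear φ w ∘ v) ≈ shear φ w (lincombF c v)
  lincombF-shear φ w {zero} c v i = begin
    L.0#                                      ≡⟨ L.zeroˡ (w i) ⟨
    L.0# L.* w i                              ≡⟨ cong (L._* w i) (trans (cong ι.map (⟨⟩-0 φ)) ι-0) ⟨
    ι.map (⟨ φ ⟩ 0V) L.* w i                  ≡⟨ L.+-identityˡ _ ⟨
    shear φ w 0V i                            ∎
  lincombF-shear φ w {suc d} c v i = begin
    c₀ L.* (v₀ i L.+ ι.map (⟨ φ ⟩ v₀) L.* w i) L.+ lincombF (c ∘ suc) (shear φ w ∘ v ∘ suc) i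
      ≡⟨ L.+-congˡ (lincombF-shear φ w (c ∘ suc) (v ∘ suc) i) ⟩
    c₀ L.* (v₀ i L.+ ι.map (⟨ φ ⟩ v₀) L.* w i) L.+ (S i L.+ ι.map (⟨ φ ⟩ S) L.* w i)
      ≡⟨ L.solve 6 (λ c v f w s g → c L.:* (v L.:+ f L.:* w) L.:+ (s L.:+ g L.:* w)
                     L.:= (c L.:* v L.:+ s) L.:+ (c L.:* f L.:+ g) L.:* w)
           refl c₀ (v₀ i) (ι.map (⟨ φ ⟩ v₀)) (w i) (S i) (ι.map (⟨ φ ⟩ S)) ⟩
    (c₀ L.* v₀ i L.+ S i) L.+ (c₀ L.* ι.map (⟨ φ ⟩ v₀) L.+ ι.map (⟨ φ ⟩ S)) L.* w i
      ≡⟨ L.+-congˡ (L.*-congʳ (L.+-congʳ (ι.map-* _ _))) ⟨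
    (c₀ L.* v₀ i L.+ S i) L.+ (ι.map (c zero F.* ⟨ φ ⟩ v₀) L.+ ι.map (⟨ φ ⟩ S)) L.* w i
      ≡⟨ L.+-congˡ (L.*-congʳ (ι.map-+ _ _)) ⟨
    (c₀ L.* v₀ i L.+ S i) L.+ ι.map (c zero F.* ⟨ φ ⟩ v₀ F.+ ⟨ φ ⟩ S) L.* w i
      ≡⟨ L.+-congˡ (L.*-congʳ (cong ι.map (trans (⟨⟩-+ φ _ _) (F.+-congʳ (⟨⟩-· φ _ _))))) ⟨
    shear φ w (lincombF c v) i ∎
    where
    c₀ = ι.map (c zero)
    v₀ = v zero
    S = lincombF (c ∘ suc) (v ∘ suc)

  Kernel : Functional → Pred
  Kernel φ u = ⟨ φ ⟩ u ≡ F.0#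

  ⋂Kernel : {I : Set} → (I → Functional) → Pred
  ⋂Kernel φs u = ∀ i → Kernel (φs i) u

  -- `X` is what the new family inherits from `b`, `Z` is what it gains. `spanning` is relative to
  -- the span of `b`, so that successive cuts compose.
  record FamilyIn {d} (b : Fin d → V) (X Z : Pred) (d′ : ℕ) : Set where
    field
      family      : Fin d′ → V
      independent : Independent family
      member      : ∀ j → X (family j)
      killed      : ∀ j → Z (family j)
      spanning    : ∀ u → Z u → InSpan b u → InSpan family u

  module _ {X : Pred} (X-sub : IsSubspaceF X) where
    open IsSubspaceF X-sub

    -- The shear v ↦ v - (φ v / φ b_p) b_p maps b_p to 0 and fixes ker φ, so
    -- it maps the other members of b to a family spanning the kernel.
    kernel-pivot : ∀ {d} {b : Fin (suc d) → V} → Independent b → (∀ j → X (b j)) →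
                   ∀ φ p → ¬ ⟨ φ ⟩ (b p) ≡ F.0# → FamilyIn b X (Kernel φ) d
    kernel-pivot {d} {b} ind b∈X φ p φbₚ≢0 = record
      { family = P ∘ removeAt b p
      ; independent = P-independent
      ; member = λ j → +∈ (b∈X _) (·∈ _ (b∈X p))
      ; killed = λ j → φP≡0 (removeAt b p j)
      ; spanning = spans
      }
      where
      y = proj₁ (F.inverse _ φbₚ≢0)
      ψ = scale (F.- y) φ
      P = shear ψ (b p)

      -yφbₚ : ((F.- y) F.* ⟨ φ ⟩ (b p)) ≡ F.- F.1#
      -yφbₚ = trans (sym (F.-‿distribˡ-* y _)) (cong F.-_ (trans (F.*-comm y _) (proj₂ (F.inverse _ φbₚ≢0))))

      -1*x : ∀ x → (F.- F.1#) F.* x ≡ F.- x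
      -1*x x = trans (sym (F.-‿distribˡ-* _ x)) (cong F.-_ (F.*-identityˡ x))

      φP≡0 : ∀ v → ⟨ φ ⟩ (P v) ≡ F.0#
      φP≡0 v = begin
        ⟨ φ ⟩ (P v)                                       ≡⟨ trans (⟨⟩-+ φ _ _) (F.+-congˡ (⟨⟩-· φ _ _)) ⟩
        φv F.+ ((F.- y) F.* φv) F.* ⟨ φ ⟩ (b p)
          ≡⟨ cong (φv F.+_) (F.solve 3 (λ z f g → (z F.:* f) F.:* g F.:= (z F.:* g) F.:* f) refl (F.- y) φv _) ⟩
        φv F.+ ((F.- y) F.* ⟨ φ ⟩ (b p)) F.* φv           ≡⟨ cong (φv F.+_) (trans (cong (F._* φv) -yφbₚ) (-1*x φv)) ⟩
        φv F.+ (F.- φv)                                   ≡⟨ F.-‿inverseʳ φv ⟩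
        F.0#                                              ∎
        where φv = ⟨ φ ⟩ v

      P-fixes : ∀ v → ⟨ φ ⟩ v ≡ F.0# → P v ≈ v
      P-fixes v φv≡0 i = begin
        v i L.+ ι.map ((F.- y) F.* ⟨ φ ⟩ v) L.* b p i
          ≡⟨ cong (λ x → v i L.+ x L.* b p i) (trans (cong ι.map (trans (F.*-congˡ φv≡0) (F.zeroʳ _))) ι-0) ⟩
        v i L.+ L.0# L.* b p i                            ≡⟨ cong (v i L.+_) (L.zeroˡ _) ⟩
        v i L.+ L.0#                                      ≡⟨ L.+-identityʳ _ ⟩
        v i                                               ∎

      Pbₚ≈0 : P (b p) ≈ 0V
      Pbₚ≈0 i = begin
        b p i L.+ ι.map ((F.- y) F.* ⟨ φ ⟩ (b p)) L.* b p i ≡⟨ L.+-congʳ (L.*-identityˡ _) ⟨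
        L.1# L.* b p i L.+ ι.map ((F.- y) F.* ⟨ φ ⟩ (b p)) L.* b p i ≡⟨ L.distribʳ _ _ _ ⟨
        (L.1# L.+ ι.map ((F.- y) F.* ⟨ φ ⟩ (b p))) L.* b p i
          ≡⟨ cong (L._* b p i) (trans (cong₂ L._+_ (sym ι.map-1) (cong ι.map -yφbₚ)) (sym (ι.map-+ _ _))) ⟩
        ι.map (F.1# F.+ (F.- F.1#)) L.* b p i             ≡⟨ cong (L._* b p i) (trans (cong ι.map (F.-‿inverseʳ _)) ι-0) ⟩
        L.0# L.* b p i                                    ≡⟨ L.zeroˡ _ ⟩
        L.0#                                              ∎

      -- A relation among the sheared vectors says u + ψ(u) b_p = 0 for a combination u of the other
      -- members of `b`. This is a relation among all of `b` with coefficient ψ(u) at p.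
      P-independent : Independent (P ∘ removeAt b p)
      P-independent c eq j = trans (sym (insertAt-punchIn c p x j)) (ind (insertAt c p x) extended (punchIn p j))
        where
        u = lincombF c (removeAt b p)
        x = ⟨ ψ ⟩ u
        extended : lincombF (insertAt c p x) b ≈ 0V
        extended i = begin
          lincombF (insertAt c p x) b i
            ≡⟨ lincomb-remove (ι.map ∘ insertAt c p x) b p i ⟩
          ι.map (insertAt c p x p) L.* b p i L.+ lincombF (insertAt c p x ∘ punchIn p) (removeAt b p) i
            ≡⟨ cong₂ L._+_ (cong (λ z → ι.map z L.* b p i) (insertAt-lookup c p x))
                 (lincombF-cong {v = removeAt b p} (insertAt-punchIn c p x) (λ _ _ → refl) i) ⟩
          ι.map x L.* b p i L.+ u i                       ≡⟨ L.+-comm _ _ ⟩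
          shear ψ (b p) u i                               ≡⟨ lincombF-shear ψ (b p) c (removeAt b p) i ⟨
          lincombF c (P ∘ removeAt b p) i                 ≡⟨ eq i ⟩
          L.0#                                            ∎

      spans : ∀ u → ⟨ φ ⟩ u ≡ F.0# → InSpan b u → InSpan (P ∘ removeAt b p) u
      spans u φu≡0 (c , u≈) = removeAt c p , λ i → begin
        u i                                               ≡⟨ u≈ i ⟩
        lincombF c b i                                    ≡⟨ P-fixes _ (trans (⟨⟩-cong φ (λ l → sym (u≈ l))) φu≡0) i ⟨
        P (lincombF c b) i                                ≡⟨ lincombF-shear ψ (b p) c b i ⟨
        lincombF c (P ∘ b) i                              ≡⟨ lincomb-remove (ι.map ∘ c) (P ∘ b) p i ⟩
        ι.map (c p) L.* P (b p) i L.+ lincombF (removeAt c p) (P ∘ removeAt b p) i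
          ≡⟨ L.+-congʳ (trans (L.*-congˡ (Pbₚ≈0 i)) (L.zeroʳ _)) ⟩
        L.0# L.+ lincombF (removeAt c p) (P ∘ removeAt b p) i ≡⟨ L.+-identityˡ _ ⟩
        lincombF (removeAt c p) (P ∘ removeAt b p) i      ∎

  ∩-⋂Kernel : ∀ {X I} → IsSubspaceF X → (φs : I → Functional) → IsSubspaceF (X ∩ ⋂Kernel φs)
  ∩-⋂Kernel X-sub φs = record
    { resp = λ eq (u∈ , φu) → resp eq u∈ , λ i → trans (sym (⟨⟩-cong (φs i) eq)) (φu i)
    ; zero∈ = zero∈ , λ i → ⟨⟩-0 (φs i)
    ; +∈ = λ (u∈ , φu) (v∈ , φv) → +∈ u∈ v∈ , λ i →
        trans (⟨⟩-+ (φs i) _ _) (trans (cong₂ F._+_ (φu i) (φv i)) (F.+-identityʳ _))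
    ; ·∈ = λ x (u∈ , φu) → ·∈ x u∈ , λ i →
        trans (⟨⟩-· (φs i) x _) (trans (F.*-congˡ (φu i)) (F.zeroʳ _))
    }
    where open IsSubspaceF X-sub

  module _ (_≟_ : DecidableEquality F.Carrier) where

    -- Nothing is lost if the functional kills the whole family; otherwise any member with nonzero
    -- value serves as the pivot and is the only loss.
    kernel-family : ∀ {X d} {b : Fin d → V} → IsSubspaceF X → Independent b → (∀ j → X (b j)) →
                    ∀ φ → Σ ℕ λ d′ → d ≤ suc d′ × FamilyIn b X (Kernel φ) d′
    kernel-family {b = b} X-sub ind b∈X φ with all? (λ j → ⟨ φ ⟩ (b j) ≟ F.0#)
    ... | yes φb≡0 = _ , ℕ.n≤1+n _ , record
      { family = b ; independent = ind ; member = b∈X ; killed = φb≡0 ; spanning = λ _ _ u∈ → u∈ }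
    ... | no φb≢0 with ¬∀⟶∃¬ _ _ (λ j → ⟨ φ ⟩ (b j) ≟ F.0#) φb≢0
    kernel-family {d = suc d} X-sub ind b∈X φ | no _ | p , φbₚ≢0 =
      d , ℕ.≤-refl , kernel-pivot X-sub ind b∈X φ p φbₚ≢0

    ⋂kernel-family : ∀ s (φs : Fin s → Functional) {X d} {b : Fin d → V} →
                     IsSubspaceF X → Independent b → (∀ j → X (b j)) →
                     Σ ℕ λ d′ → d ≤ s + d′ × FamilyIn b X (⋂Kernel φs) d′
    ⋂kernel-family zero φs {b = b} X-sub ind b∈X = _ , ℕ.≤-refl , record
      { family = b ; independent = ind ; member = b∈X ; killed = λ _ () ; spanning = λ _ _ u∈ → u∈ }
    ⋂kernel-family (suc s) φs X-sub ind b∈X with kernel-family X-sub ind b∈X (φs zero)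
    ... | d₁ , d≤ , B₁
      -- The first kernel is absorbed into the subspace, so the vectors produced by the remaining
      -- cuts are still killed by `φs zero`.
      with ⋂kernel-family s (φs ∘ suc) (∩-⋂Kernel {I = ⊤} X-sub (λ _ → φs zero))
             (FamilyIn.independent B₁) (λ j → FamilyIn.member B₁ j , λ _ → FamilyIn.killed B₁ j)
    ... | d₂ , d₁≤ , B₂ = d₂ , ℕ.≤-trans d≤ (s≤s d₁≤) , record
      { family = family
      ; independent = independent
      ; member = proj₁ ∘ member
      ; killed = λ j → λ { zero → proj₂ (member j) tt ; (suc i) → killed j i }
      ; spanning = λ u φu u∈ → spanning u (φu ∘ suc) (FamilyIn.spanning B₁ u (φu zero) u∈)
      }
      where open FamilyIn B₂

    independent-∷ : ∀ {d} {b : Fin d → V} {x} → Independent b → ¬ InSpan b x → Independent (x ∷ b)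
    independent-∷ {b = b} {x} ind x∉ c eq with c zero ≟ F.0#
    ... | yes c₀≡0 = λ { zero → c₀≡0 ; (suc i) → ind (c ∘ suc) (λ l → begin
        lincombF (c ∘ suc) b l                                      ≡⟨ L.+-identityˡ _ ⟨
        L.0# L.+ lincombF (c ∘ suc) b l
          ≡⟨ L.+-congʳ (trans (L.*-congʳ (trans (cong ι.map c₀≡0) ι-0)) (L.zeroˡ _)) ⟨
        ι.map (c zero) L.* x l L.+ lincombF (c ∘ suc) b l           ≡⟨ eq l ⟩
        L.0#                                                        ∎) i }
    ... | no c₀≢0 = contradiction ((λ j → (F.- y) F.* c (suc j)) , x≈) x∉
      where
      y = proj₁ (F.inverse _ c₀≢0)
      -y = ι.map (F.- y)
      c₀ = ι.map (c zero)
      S = lincombF (c ∘ suc) b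
      -y*c₀ : -y L.* c₀ ≡ ι.map (F.- F.1#)
      -y*c₀ = trans (sym (ι.map-* _ _)) (cong ι.map
        (trans (sym (F.-‿distribˡ-* y _)) (cong F.-_ (trans (F.*-comm y _) (proj₂ (F.inverse _ c₀≢0))))))
      x≈ : x ≈ lincombF (λ j → (F.- y) F.* c (suc j)) b
      x≈ l = trans (L.+-cancelʳ (-y L.* (c₀ L.* x l)) _ _ (begin
        x l L.+ -y L.* (c₀ L.* x l)
          ≡⟨ cong₂ L._+_ (sym (L.*-identityˡ _)) (sym (L.*-assoc _ _ _)) ⟩
        L.1# L.* x l L.+ (-y L.* c₀) L.* x l                        ≡⟨ L.distribʳ _ _ _ ⟨
        (L.1# L.+ -y L.* c₀) L.* x l
          ≡⟨ L.*-congʳ (trans (cong₂ L._+_ (sym ι.map-1) -y*c₀) (sym (ι.map-+ _ _))) ⟩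
        ι.map (F.1# F.+ (F.- F.1#)) L.* x l
          ≡⟨ L.*-congʳ (trans (cong ι.map (F.-‿inverseʳ _)) ι-0) ⟩
        L.0# L.* x l                                                ≡⟨ L.zeroˡ _ ⟩
        L.0#                                                        ≡⟨ L.zeroʳ _ ⟨
        -y L.* L.0#                                                 ≡⟨ L.*-congˡ (eq l) ⟨
        -y L.* (c₀ L.* x l L.+ S l)                                 ≡⟨ L.distribˡ _ _ _ ⟩
        -y L.* (c₀ L.* x l) L.+ -y L.* S l                          ≡⟨ L.+-comm _ _ ⟩
        -y L.* S l L.+ -y L.* (c₀ L.* x l)                          ∎))
        (sym (lincombF-· _ (c ∘ suc) b l))

  -- `span` merely picks some coefficients; their uniqueness makes the choice linear and compatible
  -- with `_≈_`.
  coordinate : ∀ {d} {b : Fin d → V} → Independent b → (∀ u → InSpan b u) → Fin d → Functional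
  coordinate {b = b} ind span i = record
    { ⟨_⟩ = λ u → proj₁ (span u) i
    ; ⟨⟩-cong = λ {u} {v} u≈v → unique u (proj₁ (span v)) (λ l → trans (u≈v l) (proj₂ (span v) l))
    ; ⟨⟩-+ = λ u v → unique (u +V v) _ (proj₂ (inSpan-+ (span u) (span v)))
    ; ⟨⟩-· = λ x u → unique (ι.map x · u) _ (proj₂ (inSpan-· x (span u)))
    }
    where
    unique : ∀ u c → u ≈ lincombF c b → proj₁ (span u) i ≡ c i
    unique u c u≈ = coefficients-unique ind _ c (λ l → trans (sym (proj₂ (span u) l)) (u≈ l)) i

-- L as an n-dimensional space over F (the case r = 1)

module FieldExtension (F L : Field) (ι : FieldEmbedding F L) (q n : ℕ)
  (F↔ : Field.Carrier F ↔ Fin q) (L↔ : Field.Carrier L ↔ Fin (q ^ n)) where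
  private
    module F = FieldProperties F
    module L = FieldProperties L
    module ι = FieldEmbedding ι
  open Over F L ι 1
  open LinearAlgebra F L ι 1
  open Functional

  inSpan? : ∀ {d} (b : Fin d → V) x → Dec (InSpan b (λ _ → x))
  inSpan? b x with any? (λ k → ↔Fin⇒≟ L↔ x (lincombF (Inverse.from F↔ ∘ finToFun k) b zero))
  ... | yes (k , eq) = yes (_ , λ { zero → eq })
  ... | no none = no λ (c , x≈) → none (funToFin (Inverse.to F↔ ∘ c) , trans (x≈ zero)
    (lincombF-cong {v = b} (λ j → sym (trans (cong (Inverse.from F↔) (Fin.finToFun-funToFin (Inverse.to F↔ ∘ c) j))
                             (Inverse.strictlyInverseʳ F↔ (c j)))) (λ _ _ → refl) zero))

  span≈ : ∀ {d} {b : Fin d → V} → (∀ x → InSpan b (λ _ → x)) → ∀ u → InSpan b u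
  span≈ span u = proj₁ (span (u zero)) , λ { zero → proj₂ (span (u zero)) zero }

  private
    q^-cancel : ∀ {s t} → ¬ q ^ t < q ^ s → s ≤ t
    q^-cancel ≮ = ℕ.≮⇒≥ (≮ ∘ ℕ.^-monoʳ-< q (F.1<card F↔))

    card-V : (q ^ n) ^ 1 ≡ q ^ n
    card-V = ℕ.*-identityʳ (q ^ n)

  -- Independence makes the q^d combinations distinct among the q^n elements of `L`; `spanning⇒n≤`
  -- counts in the opposite direction.
  independent⇒≤n : ∀ {d} {b : Fin d → V} → Independent b → d ≤ n
  independent⇒≤n {d} {b} ind = q^-cancel λ lt →
    let x , y , (i , x≢y) , eq = collision F↔ L↔ (subst (_< q ^ d) (sym card-V) lt) (λ c → lincombF c b)
    in x≢y (coefficients-unique ind x y eq i)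

  spanning⇒n≤ : ∀ {d} {b : Fin d → V} → (∀ u → InSpan b u) → n ≤ d
  spanning⇒n≤ {d} {b} span = q^-cancel λ lt →
    let x , y , (i , x≢y) , eq = collision L↔ F↔ (subst (q ^ d <_) (sym card-V) lt) (proj₁ ∘ span)
    in x≢y (trans (proj₂ (span x) i)
         (trans (lincombF-cong {v = b} eq (λ _ _ → refl) i) (sym (proj₂ (span y) i))))

  -- The invariant n ≤ fuel + d makes running out of fuel harmless: there are then at least n
  -- independent elements, and another one outside their span would contradict `independent⇒≤n`.
  extend-to-basis : ∀ fuel {d} {b : Fin d → V} → Independent b → n ≤ fuel + d →
                    Σ ℕ λ d′ → Σ (Fin d′ → V) λ b′ → Independent b′ × (∀ u → InSpan b′ u)
  extend-to-basis fuel {d} {b} ind n≤ with all? (λ k → inSpan? b (Inverse.from L↔ k))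
  ... | yes span = d , b , ind , span≈ λ x →
    subst (λ y → InSpan b (λ _ → y)) (Inverse.strictlyInverseʳ L↔ x) (span (Inverse.to L↔ x))
  ... | no ¬span with ¬∀⟶∃¬ _ _ (λ k → inSpan? b (Inverse.from L↔ k)) ¬span
  extend-to-basis zero {b = b} ind n≤ | no _ | k , x∉ =
    contradiction (ℕ.≤-trans (independent⇒≤n {b = (λ _ → Inverse.from L↔ k) ∷ b} (independent-∷ (↔Fin⇒≟ F↔) ind x∉)) n≤) ℕ.1+n≰n
  extend-to-basis (suc fuel) {d} {b} ind n≤ | no _ | k , x∉ =
    extend-to-basis fuel {b = (λ _ → Inverse.from L↔ k) ∷ b} (independent-∷ (↔Fin⇒≟ F↔) ind x∉) (subst (n ≤_) (sym (ℕ.+-suc fuel d)) n≤)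

  -- All that is needed of a basis of `L` over `F`: functionals whose common kernel is trivial.
  -- Their number is a parameter so that n can later be split as s + m.
  Coordinates : ℕ → Set
  Coordinates s = Σ (Fin s → Functional) λ φs → ∀ u → ⋂Kernel φs u → u zero ≡ L.0#

  abstract
    coordinates : Coordinates n
    coordinates with extend-to-basis n {b = λ ()} (λ _ _ ()) (ℕ.m≤m+n n 0)
    ... | d , b , ind , span = subst Coordinates (ℕ.≤-antisym (independent⇒≤n ind) (spanning⇒n≤ span))
      (coordinate ind span , λ u φu → trans (proj₂ (span u) zero)
        (trans (lincombF-cong {v = b} φu (λ _ _ → refl) zero) (lincombF-0 b zero)))

-- Dot product, standard basis and hyperplanes

module DotProduct (L : Field) (r : ℕ) where
  private
    module L = FieldProperties L
  open ≡-Reasoning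
  open Over L L (idEmbedding L) r
  open LinearAlgebra L L (idEmbedding L) r

  dot : V → V → L.Carrier
  dot a v = L.sum (λ i → a i L.* v i)

  dot-comm : ∀ a v → dot a v ≡ dot v a
  dot-comm a v = L.sum-cong-≗ (λ i → L.*-comm (a i) (v i))

  dot-cong : ∀ a {u v} → u ≈ v → dot a u ≡ dot a v
  dot-cong a eq = L.sum-cong-≗ (λ i → L.*-congˡ (eq i))

  dot-+ : ∀ a u v → dot a (u +V v) ≡ dot a u L.+ dot a v
  dot-+ a u v = trans (L.sum-cong-≗ (λ i → L.distribˡ (a i) _ _)) (L.∑-distrib-+ (λ i → a i L.* u i) _)

  dot-· : ∀ a x u → dot a (x · u) ≡ x L.* dot a u
  dot-· a x u = trans (L.sum-cong-≗ λ i →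
      L.solve 3 (λ a x u → a L.:* (x L.:* u) L.:= x L.:* (a L.:* u)) refl (a i) x (u i))
    (sym (L.*-distribˡ-sum x (λ i → a i L.* u i)))

  functional : V → Functional
  functional a = record { ⟨_⟩ = dot a ; ⟨⟩-cong = dot-cong a ; ⟨⟩-+ = dot-+ a ; ⟨⟩-· = dot-· a }

  e : Fin r → V
  e j i with i Fin.≟ j
  ... | yes _ = L.1#
  ... | no _ = L.0#

  e-diagonal : ∀ i → e i i ≡ L.1#
  e-diagonal i with i Fin.≟ i
  ... | yes _ = refl
  ... | no i≢i = contradiction refl i≢i

  e-off-diagonal : ∀ i j → ¬ i ≡ j → e j i ≡ L.0#
  e-off-diagonal i j i≢j with i Fin.≟ j
  ... | yes i≡j = contradiction i≡j i≢j
  ... | no _ = refl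

  dot-e : ∀ a p → dot a (e p) ≡ a p
  dot-e a p = begin
    dot a (e p)     ≡⟨ L.sum-single _ p (λ i i≢p → trans (L.*-congˡ (e-off-diagonal i p i≢p)) (L.zeroʳ _)) ⟩
    a p L.* e p p   ≡⟨ trans (L.*-congˡ (e-diagonal p)) (trans (L.*-comm _ _) (L.*-identityˡ _)) ⟩
    a p             ∎

  lincomb-e : ∀ c → lincomb c e ≈ c
  lincomb-e c i = begin
    lincomb c e i               ≡⟨ lincomb≡sum c e i ⟩
    L.sum (λ j → c j L.* e j i)
      ≡⟨ L.sum-single _ i (λ j j≢i → trans (L.*-congˡ (e-off-diagonal i j (j≢i ∘ sym))) (L.zeroʳ _)) ⟩
    c i L.* e i i               ≡⟨ trans (L.*-congˡ (e-diagonal i)) (trans (L.*-comm _ _) (L.*-identityˡ _)) ⟩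
    c i                         ∎

  e-independent : Independent e
  e-independent c eq i = trans (sym (lincomb-e c i)) (eq i)

  e-spanning : ∀ u → InSpan e u
  e-spanning u = u , λ i → sym (lincomb-e u i)

module _ (L : Field) {r₁ : ℕ} where
  private
    module L = Field L
  open DotProduct L (suc r₁)
  open Over L L (idEmbedding L) (suc r₁)
  open LinearAlgebra L L (idEmbedding L) (suc r₁)

  -- The cut is made in the standard basis with base field `L`. As a_p is nonzero, e_p is a pivot,
  -- so exactly one vector is lost.
  hyperplane-basis : ∀ a p → ¬ a p ≡ L.0# → Σ (Fin r₁ → V) (IsBasisF (λ v → dot a v ≡ L.0#) r₁)
  hyperplane-basis a p aₚ≢0 = family , killed , independent , λ u u∈ → spanning u u∈ (e-spanning u)
    where
    whole : IsSubspaceF (λ _ → ⊤)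
    whole = record { resp = λ _ _ → tt ; zero∈ = tt ; +∈ = λ _ _ → tt ; ·∈ = λ _ _ → tt }
    open FamilyIn (kernel-pivot whole {b = e} e-independent _ (functional a) p (aₚ≢0 ∘ trans (sym (dot-e a p))))

-- The code of an evasive subspace

module Evasive (F L : Field) (ι : FieldEmbedding F L) (q n : ℕ)
  (F↔ : Field.Carrier F ↔ Fin q) (L↔ : Field.Carrier L ↔ Fin (q ^ n)) (r₁ k : ℕ)
  {U : Over.Pred F L ι (suc r₁)} (U-sub : Over.IsSubspaceF F L ι (suc r₁) U)
  (evasive : ∀ W → Over.IsSubspaceLOfDim F L ι (suc r₁) W r₁ →
             Over.DimF≤ F L ι (suc r₁) (Over._∩_ F L ι (suc r₁) U W) k)
  {d : ℕ} {b : Fin d → Over.V F L ι (suc r₁)} (b-basis : Over.IsBasisF F L ι (suc r₁) U d b) where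
  private
    module F = FieldProperties F
    module L = FieldProperties L
    module ι = FieldEmbedding ι
    module F¹ = LinearAlgebra F L ι 1
    module OL = Over L L (idEmbedding L) (suc r₁)
    module LL = LinearAlgebra L L (idEmbedding L) (suc r₁)
  open Over F L ι (suc r₁)
  open LinearAlgebra F L ι (suc r₁)
  open DotProduct L (suc r₁) hiding (functional)
  open FieldExtension F L ι q n F↔ L↔ using (Coordinates; coordinates)

  lincomb-L : ∀ {t} (a : Fin t → L.Carrier) (v : Fin t → V) → lincomb a v ≈ OL.lincomb a v
  lincomb-L a v i = trans (lincomb≡sum a v i) (sym (LL.lincomb≡sum a v i))

  -- One F-coordinate of the entry at v in the codeword of `a`, viewed as a functional of v.
  along : F¹.Functional → V → Functional
  along φ a = record
    { ⟨_⟩ = λ v → ⟨ (λ _ → dot a v) ⟩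
    ; ⟨⟩-cong = λ eq → ⟨⟩-cong (λ _ → dot-cong a eq)
    ; ⟨⟩-+ = λ u v → trans (⟨⟩-cong (λ _ → dot-+ a u v)) (⟨⟩-+ (λ _ → dot a u) (λ _ → dot a v))
    ; ⟨⟩-· = λ x u → trans (⟨⟩-cong (λ _ → dot-· a (ι.map x) u)) (⟨⟩-· x (λ _ → dot a u))
    }
    where open F¹.Functional φ

  hyperplane : ∀ a p → ¬ a p ≡ L.0# → IsSubspaceLOfDim (λ v → dot a v ≡ L.0#) r₁
  hyperplane a p aₚ≢0 = subspace , family , member ,
    (λ c eq → independent c (λ i → trans (sym (lincomb-L c family i)) (eq i))) ,
    (λ u u∈ → proj₁ (spanning u u∈) ,
      λ i → trans (proj₂ (spanning u u∈) i) (sym (lincomb-L (proj₁ (spanning u u∈)) family i)))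
    where
    basis = hyperplane-basis L a p aₚ≢0
    family = proj₁ basis
    member = proj₁ (proj₂ basis)
    independent = proj₁ (proj₂ (proj₂ basis))
    spanning = proj₂ (proj₂ (proj₂ basis))
    subspace : IsSubspaceL (λ v → dot a v ≡ L.0#)
    subspace = record
      { resp = λ eq au → trans (sym (dot-cong a eq)) au
      ; zero∈ = LL.Functional.⟨⟩-0 (DotProduct.functional L (suc r₁) a)
      ; +∈ = λ {u} {v} au av → trans (dot-+ a u v) (trans (cong₂ L._+_ au av) (L.+-identityʳ _))
      ; ·∈ = λ x {u} au → trans (dot-· a x u) (trans (L.*-congˡ au) (L.zeroʳ _))
      }

  -- The equation a · v = 0 over `L` amounts to n equations over `F`, and cutting `b` by them yields
  -- a basis of U ∩ a^⊥. Evasiveness bounds its length by k, and `c` lies in its span.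
  weight≤k : ∀ a p → ¬ a p ≡ L.0# → ∀ {t} (c : Fin t → V) → Independent c → (∀ j → U (c j)) →
             (∀ j → dot a (c j) ≡ L.0#) → t ≤ k
  weight≤k a p aₚ≢0 c c-ind c∈U ac≡0 = ℕ.≤-trans
    (independent⇒≤span F↔ {b = family} c-ind (λ j → in-family (c j) (c∈U j) (ac≡0 j)))
    (evasive _ (hyperplane a p aₚ≢0) (proj₁ cut) family
      ((λ j → member j , proj₂ coordinates _ (killed j)) , independent , λ u (u∈U , au) → in-family u u∈U au))
    where
    cut = ⋂kernel-family (↔Fin⇒≟ F↔) n (λ i → along (proj₁ coordinates i) a) U-sub
            (proj₁ (proj₂ b-basis)) (proj₁ b-basis)
    open FamilyIn (proj₂ (proj₂ cut))
    in-family : ∀ u → U u → dot a u ≡ L.0# → InSpan family u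
    in-family u u∈U au≡0 = spanning u
      (λ i → trans (F¹.Functional.⟨⟩-cong (proj₁ coordinates i) (λ _ → au≡0))
                   (F¹.Functional.⟨⟩-0 (proj₁ coordinates i)))
      (proj₂ (proj₂ b-basis) u u∈U)

  -- If the bound fails, two codewords agree in the last m of the n coordinates
  -- of every entry, so their difference has rank at most s < t - k.
  singleton-bound : ∀ s m → s + m ≡ n → ∀ {t} → suc k + s ≤ t →
                    (c : Fin t → V) → Independent c → (∀ j → U (c j)) → suc r₁ * n ≤ t * m
  singleton-bound s m s+m≡n {t} 1+k+s≤t c c-ind c∈U = ℕ.≮⇒≥ λ lt →
    let x , y , (p , x≢y) , eq = collision L↔ F↔ {t = t * m} (card< lt) code
    in ℕ.<-irrefl refl (k<k x y p x≢y eq)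
    where
    φ : Fin (s + m) → F¹.Functional
    φ = proj₁ (subst Coordinates (sym s+m≡n) coordinates)
    φ-joint : ∀ u → F¹.⋂Kernel φ u → u zero ≡ L.0#
    φ-joint = proj₂ (subst Coordinates (sym s+m≡n) coordinates)

    card< : t * m < suc r₁ * n → q ^ (t * m) < (q ^ n) ^ suc r₁
    card< lt = subst (q ^ (t * m) <_)
      (trans (cong (q ^_) (ℕ.*-comm (suc r₁) n)) (sym (ℕ.^-*-assoc q n (suc r₁))))
      (ℕ.^-monoʳ-< q (F.1<card F↔) lt)

    kept : Fin m → V → Functional
    kept i = along (φ (s ↑ʳ i))

    -- The punctured codeword of `x`: a position encodes a member of `c` together with one of the m
    -- kept coordinates.
    code : V → Fin (t * m) → F.Carrier
    code x l = let j , i = remQuot {t} m l in Functional.⟨_⟩ (kept i x) (c j)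

    k<k : ∀ x y p → ¬ x p ≡ y p → (∀ l → code x l ≡ code y l) → k < k
    k<k x y p x≢y eq = ℕ.≤-trans k<d′
      (weight≤k a p (x≢y ∘ L.x-y≡0⇒x≡y) family independent (proj₁ ∘ member)
        (λ j → φ-joint _ (all-killed j)))
      where
      a : V
      a i = x i L.+ (L.- y i)
      kept≡0 : ∀ j i → Functional.⟨_⟩ (kept i a) (c j) ≡ F.0#
      kept≡0 j i = F.+-cancelʳ (Functional.⟨_⟩ (kept i y) (c j)) _ _ (begin
        ⟨ (λ _ → dot a (c j)) ⟩ F.+ ⟨ (λ _ → dot y (c j)) ⟩   ≡⟨ ⟨⟩-+ _ _ ⟨
        ⟨ (λ _ → dot a (c j) L.+ dot y (c j)) ⟩               ≡⟨ ⟨⟩-cong (λ _ → a+y≡x) ⟩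
        ⟨ (λ _ → dot x (c j)) ⟩                               ≡⟨ agree ⟩
        ⟨ (λ _ → dot y (c j)) ⟩                               ≡⟨ F.+-identityˡ _ ⟨
        F.0# F.+ ⟨ (λ _ → dot y (c j)) ⟩                      ∎)
        where
        open ≡-Reasoning
        open F¹.Functional (φ (s ↑ʳ i))
        agree : ⟨ (λ _ → dot x (c j)) ⟩ ≡ ⟨ (λ _ → dot y (c j)) ⟩
        agree = subst (λ (j , i) → Functional.⟨_⟩ (kept i x) (c j) ≡ Functional.⟨_⟩ (kept i y) (c j))
                  (Fin.remQuot-combine {t} j i) (eq (combine j i))
        a+y≡x : dot a (c j) L.+ dot y (c j) ≡ dot x (c j)
        a+y≡x = begin
          dot a (c j) L.+ dot y (c j)   ≡⟨ cong₂ L._+_ (dot-comm a (c j)) (dot-comm y (c j)) ⟩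
          dot (c j) a L.+ dot (c j) y   ≡⟨ dot-+ (c j) a y ⟨
          dot (c j) (a +V y)            ≡⟨ dot-cong (c j) (λ l → L.x-y+y≡x (x l) (y l)) ⟩
          dot (c j) x                   ≡⟨ dot-comm (c j) x ⟩
          dot x (c j)                   ∎
      -- The kept functionals vanish on all of `c` already, so they go into the subspace for free.
      -- Only the s others can cost a vector, which leaves at least t - s > k vectors in a^⊥.
      cut = ⋂kernel-family (↔Fin⇒≟ F↔) s (λ i → along (φ (i ↑ˡ m)) a)
              (∩-⋂Kernel U-sub (λ i → kept i a)) c-ind (λ j → c∈U j , λ i → kept≡0 j i)
      d′ = proj₁ cut
      open FamilyIn (proj₂ (proj₂ cut))
      k<d′ : k < d′
      k<d′ = ℕ.+-cancelˡ-≤ s (suc k) d′ (subst (_≤ s + d′) (ℕ.+-comm (suc k) s) (ℕ.≤-trans 1+k+s≤t (proj₁ (proj₂ cut))))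
      all-killed : ∀ j i → F¹.Functional.⟨_⟩ (φ i) (λ _ → dot a (family j)) ≡ F.0#
      all-killed j = ↑-elim s (λ i → F¹.Functional.⟨_⟩ (φ i) (λ _ → dot a (family j)) ≡ F.0#)
        (killed j) (proj₂ (member j))

  singleton-bound-U : ∀ s m → s + m ≡ n → suc k + s ≤ d → suc r₁ * n ≤ (suc k + s) * m
  singleton-bound-U s m s+m≡n ≤d =
    let f , ind = independent-subfamily {b = b} ≤d (proj₁ (proj₂ b-basis))
    in singleton-bound s m s+m≡n ℕ.≤-refl (b ∘ f) ind (proj₁ b-basis ∘ f)

  -- The F-basis `b` of `U` also generates the L-span of `U` over `L`.
  dimL-span≤d : ∀ {h} → DimL≥ (SpanL U) h → h ≤ d
  dimL-span≤d (d₀ , b₀ , (b₀∈ , ind , _) , h≤) = ℕ.≤-trans h≤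
    (LL.independent⇒≤span L↔ {c = b₀} {b = b}
      (λ c eq → ind c (λ i → trans (lincomb-L c b₀ i) (eq i)))
      (λ j → let m , u , u∈ , a , b₀≈ = b₀∈ j
                 c , eq = LL.inSpan-lincombF {b = b} a u (λ l → U⊆span (u l) (u∈ l))
             in c , λ i → trans (b₀≈ i) (trans (lincomb-L a u i) (eq i))))
    where
    U⊆span : ∀ u → U u → LL.InSpan b u
    U⊆span u u∈ = let c , eq = proj₂ (proj₂ b-basis) u u∈ in
      ι.map ∘ c , λ i → trans (eq i) (lincomb-L (ι.map ∘ c) b i)

-- Choice of parameters in the two cases

private
  -- Failure of (2) says that d is at least t = n + k - r + 2. Writing k = r₁ + e and n = s + r₁
  -- turns t into 1 + k + s without truncated subtraction.
  part₂-size : ∀ {n d} r₁ e s → n ≡ s + r₁ → n + (r₁ + e) + 1 < d + suc r₁ → suc (r₁ + e) + s ≤ d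
  part₂-size {d = d} r₁ e s refl lt = ℕ.+-cancelʳ-≤ (suc r₁) _ _ (subst (_≤ d + suc r₁)
    (solve 3 (λ r e s → con 1 :+ (s :+ r :+ (r :+ e) :+ con 1) := (con 1 :+ (r :+ e) :+ s) :+ (con 1 :+ r)) refl r₁ e s) lt)
    where open +-*-Solver

theorem4p2 : (q n r k : ℕ) (F L : Field) (ι : FieldEmbedding F L)
    → Field.Carrier F ↔ Fin q
    → Field.Carrier L ↔ Fin (q ^ n)
    → 2 ≤ r → 1 ≤ k
    → (U : Over.Pred F L ι r)
    → Over.IsSubspaceF F L ι r U
    → Over.IsEvasive F L ι r (r ∸ 1) k U
    → (k < (r ∸ 1) * n
    → ∀ d (b : Fin d → Over.V F L ι r) → Over.IsBasisF F L ι r U d b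
    → d + 1 ≤ n + k)
    × ((r ∸ 1) * k < (r ∸ 1) * (r ∸ 2) + n
    → ∀ d (b : Fin d → Over.V F L ι r) → Over.IsBasisF F L ι r U d b
    → d + r ≤ n + k + 1)
-- For n = 0 the field `L` would have q^0 = 1 element.
theorem4p2 q zero r k F L ι F↔ L↔ _ _ U U-sub _ =
  contradiction (FieldProperties.1<card L L↔) (ℕ.<-irrefl refl)
theorem4p2 q n@(suc n₁) (suc r₁@(suc r₂)) k F L ι F↔ L↔ (s≤s (s≤s _)) _ U U-sub (span≥ , evasive) = part₁ , part₂
  where
  open +-*-Solver

  part₁ : k < r₁ * n → ∀ d (b : Fin d → Over.V F L ι (suc r₁)) → Over.IsBasisF F L ι (suc r₁) U d b →
          d + 1 ≤ n + k
  -- Here m = 1 and s = n - 1: failure gives d ≥ n + k = 1 + k + s, and the bound becomes rn ≤ n +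
  -- k.
  part₁ k< d b b-basis = ℕ.≮⇒≥ λ lt → ℕ.<⇒≱ (ℕ.+-monoʳ-< n k<) (subst (suc r₁ * n ≤_)
      (solve 2 (λ k m → (con 1 :+ k :+ m) :* con 1 := con 1 :+ m :+ k) refl k n₁)
      (singleton-bound-U n₁ 1 (ℕ.+-comm n₁ 1) (s≤s⁻¹ (subst₂ _≤_
        (solve 2 (λ k m → con 1 :+ (con 1 :+ m :+ k) := con 1 :+ (con 1 :+ k :+ m)) refl k n₁)
        (ℕ.+-comm d 1) lt))))
    where open Evasive F L ι q n F↔ L↔ r₁ k U-sub evasive b-basis

  part₂ : r₁ * k < r₁ * r₂ + n → ∀ d (b : Fin d → Over.V F L ι (suc r₁)) → Over.IsBasisF F L ι (suc r₁) U d b →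
          d + suc r₁ ≤ n + k + 1
  part₂ r₁k< d b b-basis = ℕ.≮⇒≥ contra
    where
    open Evasive F L ι q n F↔ L↔ r₁ k U-sub evasive b-basis
    open ℕ.≤-Reasoning

    -- Otherwise k + 1 ≤ r₁ ≤ d, the last step by the span condition. Without puncturing (s = 0, m =
    -- n) the bound gives rn ≤ (k + 1)n ≤ (r - 1)n. Geometrically, k + 1 ≤ r - 1 vectors of `U`
    -- always lie in a common hyperplane.
    r₁≤k : r₁ ≤ k
    r₁≤k = ℕ.≮⇒≥ λ k<r₁ → ℕ.<⇒≱ (ℕ.m<n+m (r₁ * n) (s≤s z≤n)) (begin
      suc r₁ * n        ≤⟨ singleton-bound-U 0 n refl
                             (subst (_≤ d) (sym (ℕ.+-identityʳ (suc k))) (ℕ.≤-trans k<r₁ (dimL-span≤d span≥))) ⟩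
      (suc k + 0) * n   ≡⟨ cong (_* n) (ℕ.+-identityʳ (suc k)) ⟩
      suc k * n         ≤⟨ ℕ.*-monoˡ-≤ n k<r₁ ⟩
      r₁ * n            ∎)

    e = proj₁ (ℕ.m≤n⇒∃[o]m+o≡n r₁≤k)
    r₁+e≡k = proj₂ (ℕ.m≤n⇒∃[o]m+o≡n r₁≤k)

    -- The hypothesis of (2) free of subtraction, since k - r + 2 = 1 + e. It also shows that m = r₁
    -- coordinates can be kept.
    r₁[1+e]<n : r₁ * suc e < n
    r₁[1+e]<n = ℕ.+-cancelˡ-< (r₁ * r₂) _ _ (begin-strict
      r₁ * r₂ + r₁ * suc e   ≡⟨ solve 2 (λ r e → (con 1 :+ r) :* r :+ (con 1 :+ r) :* (con 1 :+ e)
                                  := (con 1 :+ r) :* (con 1 :+ r :+ e)) refl r₂ e ⟩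
      r₁ * (r₁ + e)          ≡⟨ cong (r₁ *_) r₁+e≡k ⟩
      r₁ * k                 <⟨ r₁k< ⟩
      r₁ * r₂ + n            ∎)

    r₁≤n : r₁ ≤ n
    r₁≤n = ℕ.≤-trans (ℕ.m≤m*n r₁ (suc e)) (ℕ.<⇒≤ r₁[1+e]<n)

    s = n ∸ r₁
    s+r₁≡n = ℕ.m∸n+n≡m r₁≤n

    contra : ¬ n + k + 1 < d + suc r₁
    -- With m = r₁, splitting rn as n + r₁n and cancelling r₁n leaves n ≤ r₁(1 + e).
    contra lt = ℕ.<⇒≱ r₁[1+e]<n (ℕ.+-cancelʳ-≤ (r₁ * n) _ _ (begin
      n + r₁ * n                          ≤⟨ singleton-bound-U s r₁ s+r₁≡n
                                               (subst (λ k → suc k + s ≤ d) r₁+e≡k (part₂-size r₁ e s (sym s+r₁≡n)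
                                                 (subst (λ k → n + k + 1 < d + suc r₁) (sym r₁+e≡k) lt))) ⟩
      (suc k + s) * r₁                    ≡⟨ cong (λ k → (suc k + s) * r₁) r₁+e≡k ⟨
      (suc (r₁ + e) + s) * r₁             ≡⟨ solve 3 (λ r e s → (con 1 :+ (r :+ e) :+ s) :* r
                                               := r :* (con 1 :+ e) :+ r :* (s :+ r)) refl r₁ e s ⟩
      r₁ * suc e + r₁ * (s + r₁)          ≡⟨ cong (λ n → r₁ * suc e + r₁ * n) s+r₁≡n ⟩
      r₁ * suc e + r₁ * n                 ∎))
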